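{- For all integers $k\ge 2$ and $m\ge 2$, there is a strongly connected, $k$-regular digraph on $mk$ vertices with an edge-labelling by $\mathbb{Z}_k$ and no zero-sum directed cycle.
   Context: All digraphs are finite, simple and loopless: for each ordered pair $(u,v)$ there is at most one edge from $u$ to $v$, there are no edges from a vertex to itself, and both opposite edges $uv$ and $vu$ may be present. A digraph is $k$-regular if every vertex has outdegree $k$ and indegree $k$. A directed cycle $C=v_1v_2\cdots v_\ell v_1$ has distinct vertices $v_1,\dots,v_\ell$ and all displayed edges in the digraph (so $\ell\ge 2$). $\mathbb{Z}_k$ is the cyclic group of integers modulo $k$ under addition. For an edge-labelling by $\mathbb{Z}_k$, a directed cycle is zero-sum if the sum of its edge labels is $0$ in $\mathbb{Z}_k$. -}

module Defs where

open import Data.Bool.Base using (Bool; T)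
open import Data.Fin.Base using (Fin; zero; suc; inject₁; fromℕ; toℕ)
open import Data.Fin.Subset using (Subset; ∣_∣)
open import Data.Nat.Base using (ℕ; suc; _+_; NonZero)
open import Data.Nat.DivMod using (_mod_)
open import Data.Product.Base using (_×_)
open import Data.Vec.Base using (tabulate)
open import Data.Vec.Functional using (foldr)
open import Function.Definitions using (Injective)
open import Relation.Binary.Construct.Closure.ReflexiveTransitive using (Star)
open import Relation.Binary.PropositionalEquality.Core using (_≡_)
open import Relation.Nullary.Negation.Core using (¬_)

-- Residues 0, …, k − 1 under addition modulo k.
ℤmod : ℕ → Set
ℤmod k = Fin k

module _ {k : ℕ} .{{_ : NonZero k}} where

  0ₖ : ℤmod k
  0ₖ = 0 mod k

  infixl 6 _+ₖ_

  _+ₖ_ : ℤmod k → ℤmod k → ℤmod k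
  a +ₖ b = (toℕ a + toℕ b) mod k

  sumₖ : {n : ℕ} → (Fin n → ℤmod k) → ℤmod k
  sumₖ = foldr _+ₖ_ 0ₖ

record Digraph (n : ℕ) : Set where
  field
    adj      : Fin n → Fin n → Bool
    loopless : ∀ v → ¬ T (adj v v)

  -- Proof-irrelevant, since T b has at most one element: there is at most
  -- one edge from u to v.
  Edge : Fin n → Fin n → Set
  Edge u v = T (adj u v)

  outNeighbours inNeighbours : Fin n → Subset n
  outNeighbours v = tabulate (λ w → adj v w)
  inNeighbours  v = tabulate (λ u → adj u v)

  outdegree indegree : Fin n → ℕ
  outdegree v = ∣ outNeighbours v ∣
  indegree  v = ∣ inNeighbours v ∣

  Regular : ℕ → Set
  Regular k = ∀ v → outdegree v ≡ k × indegree v ≡ k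

  StronglyConnected : Set
  StronglyConnected = ∀ u v → Star Edge u v

  EdgeLabelling : Set → Set
  EdgeLabelling A = ∀ u v → Edge u v → A

  -- The cycle v₀ v₁ ⋯ v_r v₀, of length r + 1.  The case r = 0 would need a
  -- loop at v₀, so looplessness forces the length to be at least 2.
  record DirectedCycle : Set where
    field
      r        : ℕ
      vertex   : Fin (suc r) → Fin n
      distinct : Injective _≡_ _≡_ vertex
      step     : (i : Fin r) → Edge (vertex (inject₁ i)) (vertex (suc i))
      close    : Edge (vertex (fromℕ r)) (vertex zero)

  module _ {k : ℕ} .{{_ : NonZero k}} (label : EdgeLabelling (ℤmod k)) where

    cycleSum : DirectedCycle → ℤmod k
    cycleSum C = sumₖ (λ i → label (vertex (inject₁ i)) (vertex (suc i)) (step i))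
                 +ₖ label (vertex (fromℕ r)) (vertex zero) close
      where open DirectedCycle C

    ZeroSum : DirectedCycle → Set
    ZeroSum C = cycleSum C ≡ 0ₖ

{-# OPTIONS --safe #-}

-- Place N = m k vertices on a circle and join u to u + 1, …, u + k (mod N),
-- labelling by 1 the edges that pass the point between N − 1 and 0 and by 0
-- the others.  A cycle of length l winds w times around the circle, where w is
-- its integer label sum and N w is its total advance, so
-- 0 < l ≤ N w ≤ k l ≤ k N and hence 1 ≤ w ≤ k.  If w = k then every edge
-- advances by exactly k, so the l = N vertices of the cycle agree modulo k,
-- whereas a residue class has only m < N elements.
module Submission where

open import Defs
open import Data.Bool.Base using (Bool; true; false; if_then_else_)
open import Data.Fin.Base using (Fin; zero; suc; inject₁; fromℕ; toℕ; fromℕ<)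
open import Data.Fin.Induction using (<-weakInduction; >-weakInduction)
open import Data.Fin.Properties
  using (toℕ<n; toℕ-inject₁; toℕ-fromℕ; toℕ-fromℕ<; toℕ-injective; injective⇒≤; fromℕ<-injective)
open import Data.Fin.Subset using (∣_∣)
open import Data.Nat.Base
open import Data.Nat.Divisibility using (n∣m*n; ∣m⇒∣m*n)
open import Data.Nat.DivMod
open import Data.Nat.Properties
open import Data.Nat.Tactic.RingSolver using (solve; solve-∀)
open import Data.List.Base using ([]; _∷_)
open import Data.Product.Base using (Σ-syntax; ∃-syntax; _×_; _,_; proj₁; proj₂)
open import Data.Sum.Base using (_⊎_; inj₁; inj₂; [_,_]′)
open import Data.Vec.Base using (tabulate)
open import Data.Vec.Functional using (foldr)
open import Function.Base using (_∘_; id)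
open import Function.Definitions using (Injective)
open import Relation.Binary.Construct.Closure.ReflexiveTransitive using (Star; ε; _◅_; _◅◅_)
open import Relation.Binary.PropositionalEquality
open import Relation.Nullary.Decidable
  using (Dec; yes; no; ⌊_⌋; isYes≗does; toWitness; fromWitness; dec-true; dec-false; _×-dec_; _⊎-dec_)
open import Relation.Nullary.Reflects using (ofʸ; ofⁿ)
open import Relation.Nullary.Negation.Core using (¬_; contradiction)
open Digraph using (Edge; Regular; StronglyConnected; EdgeLabelling; DirectedCycle; ZeroSum; cycleSum)

-- Counting a Boolean predicate on consecutive blocks

weight : Bool → ℕ → ℕ
weight b n = if b then n else 0

count-const : ∀ n (q : ℕ → Bool) {b} → (∀ {i} → i < n → q i ≡ b) →
              ∣ tabulate {n = n} (q ∘ toℕ) ∣ ≡ weight b n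
count-const zero    q {true}  _  = refl
count-const zero    q {false} _  = refl
count-const (suc n) q {true}  eq rewrite eq {0} z<s = cong suc (count-const n (q ∘ suc) (eq ∘ s<s))
count-const (suc n) q {false} eq rewrite eq {0} z<s = count-const n (q ∘ suc) (eq ∘ s<s)

count-+ : ∀ a b (q : ℕ → Bool) →
          ∣ tabulate {n = a + b} (q ∘ toℕ) ∣ ≡
          ∣ tabulate {n = a} (q ∘ toℕ) ∣ + ∣ tabulate {n = b} (λ i → q (a + toℕ i)) ∣
count-+ zero    b q = refl
count-+ (suc a) b q with q 0 | count-+ a b (q ∘ suc)
... | true  | ih = cong suc ih
... | false | ih = ih

-- Rows and columns of the adjacency matrix below are constant on three consecutive blocks, so both
-- degree counts reduce to this.
count-intervals : ∀ a b c N → a + (b + c) ≡ N → (q : ℕ → Bool) → ∀ {x y z} →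
                  (∀ {i} → i < a → q i ≡ x) →
                  (∀ {i} → a ≤ i → i < a + b → q i ≡ y) →
                  (∀ {i} → a + b ≤ i → i < N → q i ≡ z) →
                  ∣ tabulate {n = N} (q ∘ toℕ) ∣ ≡ weight x a + (weight y b + weight z c)
count-intervals a b c N refl q px py pz =
  trans (count-+ a (b + c) q) (cong₂ _+_ (count-const a q px)
    (trans (count-+ b c (λ i → q (a + i))) (cong₂ _+_
      (count-const b (λ i → q (a + i)) λ i<b → py (m≤m+n a _) (+-monoʳ-< a i<b))
      (count-const c (λ i → q (a + (b + i))) λ i<c →
        pz (+-monoʳ-≤ a (m≤m+n b _)) (+-monoʳ-< a (+-monoʳ-< b i<c))))))

-- Sums of bounded steps and telescoping

sum : ∀ {n} → (Fin n → ℕ) → ℕ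
sum = foldr _+_ 0

n≤sum : ∀ {n} (d : Fin n → ℕ) → (∀ i → 1 ≤ d i) → n ≤ sum d
n≤sum {zero}  d 1≤d = z≤n
n≤sum {suc n} d 1≤d = +-mono-≤ (1≤d zero) (n≤sum (d ∘ suc) (1≤d ∘ suc))

sum≤n*k : ∀ {n k} (d : Fin n → ℕ) → (∀ i → d i ≤ k) → sum d ≤ n * k
sum≤n*k {zero}  d d≤k = z≤n
sum≤n*k {suc n} d d≤k = +-mono-≤ (d≤k zero) (sum≤n*k (d ∘ suc) (d≤k ∘ suc))

-- Equality case of `sum≤n*k`: a term below `k` cannot be made up for by the others, which are at
-- most `k` each.
sum-maximal : ∀ {n k} (d : Fin n → ℕ) → (∀ i → d i ≤ k) → n * k ≤ sum d → ∀ i → d i ≡ k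
sum-maximal {suc n} {k} d d≤k nk≤ zero = ≤-antisym (d≤k zero)
  (+-cancelʳ-≤ (n * k) k (d zero)
    (≤-trans nk≤ (+-monoʳ-≤ (d zero) (sum≤n*k (d ∘ suc) (d≤k ∘ suc)))))
sum-maximal {suc n} {k} d d≤k nk≤ (suc i) = sum-maximal (d ∘ suc) (d≤k ∘ suc)
  (+-cancelˡ-≤ k (n * k) _ (≤-trans nk≤ (+-monoˡ-≤ _ (d≤k zero)))) i

-- Step `i` moves from `x (inject₁ i)` by `d i` and is reduced by `N` a total of `w i` times;
-- keeping `N * w i` on the left avoids subtraction.
telescope : ∀ N {r} (x : Fin (suc r) → ℕ) (w d : Fin r → ℕ) →
            (∀ i → x (suc i) + N * w i ≡ x (inject₁ i) + d i) →
            x (fromℕ r) + N * sum w ≡ x zero + sum d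
telescope N {zero}  x w d eq = cong (x zero +_) (*-zeroʳ N)
telescope N {suc r} x w d eq = begin
  xᵣ + N * (w₀ + W)    ≡⟨ distrib xᵣ N w₀ W ⟩
  xᵣ + N * W + N * w₀  ≡⟨ cong (_+ N * w₀) (telescope N (x ∘ suc) (w ∘ suc) (d ∘ suc) (eq ∘ suc)) ⟩
  x₁ + D + N * w₀      ≡⟨ swap x₁ D (N * w₀) ⟩
  x₁ + N * w₀ + D      ≡⟨ cong (_+ D) (eq zero) ⟩
  x₀ + d₀ + D          ≡⟨ +-assoc x₀ d₀ D ⟩
  x₀ + (d₀ + D)        ∎
  where
  open ≡-Reasoning
  xᵣ = x (fromℕ (suc r))
  x₀ = x zero
  x₁ = x (suc zero)
  w₀ = w zero
  d₀ = d zero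
  W = sum (w ∘ suc)
  D = sum (d ∘ suc)
  distrib : ∀ a n p q → a + n * (p + q) ≡ a + n * q + n * p
  distrib = solve-∀
  swap : ∀ a b c → a + b + c ≡ a + c + b
  swap = solve-∀

-- Reduction of sums modulo k

toℕ-mod : ∀ a k .{{_ : NonZero k}} → toℕ (a mod k) ≡ a % k
toℕ-mod a k = toℕ-fromℕ< (m%n<n a k)

mod-+ₖ : ∀ a b k .{{_ : NonZero k}} → (a mod k) +ₖ (b mod k) ≡ (a + b) mod k
mod-+ₖ a b k = toℕ-injective (begin
  toℕ ((a mod k) +ₖ (b mod k))           ≡⟨ toℕ-mod _ k ⟩
  (toℕ (a mod k) + toℕ (b mod k)) % k    ≡⟨ cong₂ (λ x y → (x + y) % k) (toℕ-mod a k) (toℕ-mod b k) ⟩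
  (a % k + b % k) % k                    ≡⟨ %-distribˡ-+ a b k ⟨
  (a + b) % k                            ≡⟨ toℕ-mod (a + b) k ⟨
  toℕ ((a + b) mod k)                    ∎)
  where open ≡-Reasoning

sumₖ-mod : ∀ k .{{_ : NonZero k}} {n} (w : Fin n → ℕ) → sumₖ (λ i → w i mod k) ≡ sum w mod k
sumₖ-mod k {zero}  w = refl
sumₖ-mod k {suc n} w =
  trans (cong ((w zero mod k) +ₖ_) (sumₖ-mod k (w ∘ suc))) (mod-+ₖ (w zero) (sum (w ∘ suc)) k)

-- The circulant digraph and its degrees

Wraps : (k N u v : ℕ) → Set
Wraps k N u v = v + N ≤ u + k

-- Unrolled to the integers, the head lies in the interval from `u + 1` to `u + k`, either as `v` or
-- as `v + N`. In the second case `u < v + N` follows from `u < N`.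
Arc : (k N u v : ℕ) → Set
Arc k N u v = (u < v × v ≤ u + k) ⊎ Wraps k N u v

arc? : ∀ k N u v → Dec (Arc k N u v)
arc? k N u v = (u <? v ×-dec v ≤? u + k) ⊎-dec v + N ≤? u + k

isArc : (k N u v : ℕ) → Bool
isArc k N u v = ⌊ arc? k N u v ⌋

isArc-true : ∀ {k N u v} → Arc k N u v → isArc k N u v ≡ true
isArc-true {k} {N} {u} {v} arc = trans (isYes≗does (arc? k N u v)) (dec-true (arc? k N u v) arc)

isArc-false : ∀ {k N u v} → ¬ Arc k N u v → isArc k N u v ≡ false
isArc-false {k} {N} {u} {v} ¬arc = trans (isYes≗does (arc? k N u v)) (dec-false (arc? k N u v) ¬arc)

circulant : ∀ k N → k < N → Digraph N
circulant k N k<N = record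
  { adj      = λ u v → isArc k N (toℕ u) (toℕ v)
  ; loopless = λ v e → [ (λ (v<v , _) → <-irrefl refl v<v)
                       , (λ v+N≤v+k → <⇒≱ k<N (+-cancelˡ-≤ (toℕ v) N k v+N≤v+k)) ]′ (toWitness e)
  }

count-outArcs : ∀ k N v → k < N → v < N → ∣ tabulate {n = N} (isArc k N v ∘ toℕ) ∣ ≡ k
count-outArcs k N v k<N v<N with v + k <? N
...   | yes v+k<N with m≤n⇒∃[o]m+o≡n v+k<N
...     | c , refl = trans
          (count-intervals (suc v) k c N (solve (v ∷ k ∷ c ∷ [])) (isArc k N v)
            (λ {w} w≤v → isArc-false
              [ (λ (v<w , _) → <⇒≱ v<w (s≤s⁻¹ w≤v)) , noWrap {w} ]′)
            (λ v<w w≤v+k → isArc-true (inj₁ (v<w , s≤s⁻¹ w≤v+k)))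
            (λ {w} v+k<w _ → isArc-false
              [ (λ (_ , w≤v+k) → <⇒≱ v+k<w w≤v+k) , noWrap {w} ]′))
          (+-identityʳ k)
  where
  noWrap : ∀ {w} → ¬ Wraps k N v w
  noWrap {w} w+N≤v+k = <⇒≱ v+k<N (≤-trans (m≤n+m N w) w+N≤v+k)
-- With `N + e = v + k`, the out-neighbours are `0` to `e` and `v + 1` to `N - 1`. As `k < N` gives
-- `e < v`, the gap between these blocks has length `v - e = b + 1` and ends at `v`.
count-outArcs k N v k<N v<N | no v+k≮N
  with m≤n⇒∃[o]m+o≡n (≮⇒≥ v+k≮N) | m≤n⇒∃[o]m+o≡n v<N
...     | e , N+e≡v+k | c , refl with m≤n⇒∃[o]m+o≡n e<v
  where
  e<v : e < v
  e<v = +-cancelˡ-< N e v (subst (_< N + v) (sym N+e≡v+k)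
          (subst (v + k <_) (+-comm v N) (+-monoʳ-< v k<N)))
...       | b , refl = trans
          (count-intervals (suc e) (suc b) c N (solve (e ∷ b ∷ c ∷ [])) (isArc k N v)
            (λ {w} w≤e → isArc-true (inj₂
              (subst (w + N ≤_) (trans (+-comm e N) N+e≡v+k) (+-monoˡ-≤ N (s≤s⁻¹ w≤e)))))
            (λ {w} e<w w<v+1 → isArc-false
              [ (λ (v<w , _) → <⇒≱ v<w (s≤s⁻¹ (subst (w <_) (cong suc (+-suc e b)) w<v+1)))
              , (λ w+N≤v+k → <⇒≱ e<w (+-cancelʳ-≤ N w e
                  (subst (w + N ≤_) (trans (sym N+e≡v+k) (+-comm N e)) w+N≤v+k))) ]′)
            (λ {w} v<w w<N → isArc-true (inj₁
              ( subst (_≤ w) (cong suc (+-suc e b)) v<w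
              , ≤-trans (<⇒≤ w<N) (≮⇒≥ v+k≮N)))))
          (+-cancelˡ-≡ v _ _ (trans (rotate v e c) N+e≡v+k))
  where
  rotate : ∀ v e c → v + (suc e + c) ≡ suc v + c + e
  rotate = solve-∀

count-inArcs : ∀ k N v → k < N → v < N → ∣ tabulate {n = N} ((λ u → isArc k N u v) ∘ toℕ) ∣ ≡ k
count-inArcs k N v k<N v<N with k ≤? v
...   | yes k≤v with m≤n⇒∃[o]m+o≡n k≤v | m≤n⇒∃[o]m+o≡n (<⇒≤ v<N)
...     | a , refl | c , refl = trans
          (count-intervals a k c N (solve (a ∷ k ∷ c ∷ [])) (λ u → isArc k N u v)
            (λ {u} u<a → isArc-false
              [ (λ (_ , v≤u+k) → <⇒≱ u<a (+-cancelʳ-≤ k a u (subst (_≤ u + k) (+-comm k a) v≤u+k)))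
              , noWrap (<-trans u<a (≤-<-trans (m≤n+m a k) v<N)) ]′)
            (λ {u} a≤u u<v → isArc-true (inj₁
              ( subst (u <_) (+-comm a k) u<v
              , subst (_≤ u + k) (+-comm a k) (+-monoˡ-≤ k a≤u))))
            (λ {u} v≤u u<N → isArc-false
              [ (λ (u<v , _) → <⇒≱ u<v (subst (_≤ u) (+-comm a k) v≤u)) , noWrap u<N ]′))
          (+-identityʳ k)
  where
  noWrap : ∀ {u} → u < N → ¬ Wraps k N u v
  noWrap {u} u<N v+N≤u+k = <⇒≱ (+-mono-<-≤ u<N k≤v) (subst (_≤ u + k) (+-comm v N) v+N≤u+k)
-- Here `k = v + c` and `N = k + b`: the in-neighbours are the first `v` and the last `c` vertices.
count-inArcs k N v k<N v<N | no k≰v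
  with m≤n⇒∃[o]m+o≡n (<⇒≤ (≰⇒> k≰v)) | m≤n⇒∃[o]m+o≡n (<⇒≤ k<N)
...     | c , refl | b , refl =
          count-intervals v b c N (solve (v ∷ b ∷ c ∷ [])) (λ u → isArc k N u v)
            (λ {u} u<v → isArc-true (inj₁ (u<v , ≤-trans (m≤m+n v c) (m≤n+m k u))))
            (λ {u} v≤u u<v+b → isArc-false
              [ (λ (u<v , _) → <⇒≱ u<v v≤u)
              , (λ v+N≤u+k → <⇒≱ u<v+b (+-cancelʳ-≤ k (v + b) u
                  (subst (_≤ u + k) (shift v k b) v+N≤u+k))) ]′)
            (λ {u} v+b≤u _ → isArc-true (inj₂
              (subst (_≤ u + k) (sym (shift v k b)) (+-monoˡ-≤ k v+b≤u))))
  where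
  shift : ∀ v k b → v + (k + b) ≡ v + b + k
  shift = solve-∀

-- Strong connectivity along the Hamiltonian cycle of unit steps

circulant-stronglyConnected : ∀ k N → 1 ≤ k → (k<N : k < N) → StronglyConnected (circulant k N k<N)
circulant-stronglyConnected k (suc n) 1≤k k<N u v = toLast u ◅◅ wrap ◅ fromFirst v
  where
  E : Fin (suc n) → Fin (suc n) → Set
  E = Edge (circulant k (suc n) k<N)

  next : ∀ i → E (inject₁ i) (suc i)
  next i = fromWitness (subst (λ j → Arc k (suc n) j (suc (toℕ i))) (sym (toℕ-inject₁ i))
    (inj₁ (≤-refl , subst (_≤ toℕ i + k) (+-comm (toℕ i) 1) (+-monoʳ-≤ (toℕ i) 1≤k))))

  wrap : E (fromℕ n) zero
  wrap = fromWitness (subst (λ j → Arc k (suc n) j 0) (sym (toℕ-fromℕ n))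
    (inj₂ (subst (_≤ n + k) (+-comm n 1) (+-monoʳ-≤ n 1≤k))))

  toLast : ∀ i → Star E i (fromℕ n)
  toLast = >-weakInduction _ ε (λ i p → next i ◅ p)

  fromFirst : ∀ i → Star E zero i
  fromFirst = <-weakInduction _ ε (λ i p → p ◅◅ next i ◅ ε)

-- The labelling and the advance of an arc

wrapCount : (k N u v : ℕ) → ℕ
wrapCount k N u v = if v + N ≤ᵇ u + k then 1 else 0

-- Adding `N` exactly when the arc wraps lifts its head to the unrolled circle, where the arc is a
-- forward step of length at most `k`.
arc-bounds : ∀ k N {u v} → u < N → Arc k N u v →
             u < v + N * wrapCount k N u v × v + N * wrapCount k N u v ≤ u + k
arc-bounds k N {u} {v} u<N arc with v + N ≤ᵇ u + k | ≤ᵇ-reflects-≤ (v + N) (u + k)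
... | true | ofʸ v+N≤u+k rewrite *-identityʳ N = ≤-trans u<N (m≤n+m N v) , v+N≤u+k
... | false | ofⁿ ¬wraps rewrite *-zeroʳ N | +-identityʳ v =
  [ id , (λ wraps → contradiction wraps ¬wraps) ]′ arc

arc-advance : ∀ k N {u v} → u < N → Arc k N u v →
              ∃[ d ] v + N * wrapCount k N u v ≡ u + d × 1 ≤ d × d ≤ k
arc-advance k N {u} u<N arc with arc-bounds k N u<N arc
... | u<x , x≤u+k with m≤n⇒∃[o]m+o≡n u<x
...   | e , u+1+e≡x = suc e , x≡ , s≤s z≤n , +-cancelˡ-≤ u (suc e) k (subst (_≤ u + k) x≡ x≤u+k)
  where x≡ = trans (sym u+1+e≡x) (sym (+-suc u e))

wrapLabel : ∀ k N .{{_ : NonZero k}} (k<N : k < N) → EdgeLabelling (circulant k N k<N) (ℤmod k)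
wrapLabel k N _ u v _ = wrapCount k N (toℕ u) (toℕ v) mod k

-- Once the remainder is fixed, a number is determined by its quotient by `k`, and the quotients
-- here are below `m`.
injective-const-%⇒≤ : ∀ {l} m k .{{_ : NonZero k}} (f : Fin l → Fin (m * k)) → Injective _≡_ _≡_ f →
                      ∀ c → (∀ i → toℕ (f i) % k ≡ c) → l ≤ m
injective-const-%⇒≤ m k f f-inj c f%k≡c = injective⇒≤ {f = λ i → fromℕ< (quotient<m i)} λ {i} {j} eq →
  f-inj (toℕ-injective (begin
    toℕ (f i)                              ≡⟨ m≡m%n+[m/n]*n (toℕ (f i)) k ⟩
    toℕ (f i) % k + toℕ (f i) / k * k      ≡⟨ cong₂ (λ a b → a + b * k)
                                                (trans (f%k≡c i) (sym (f%k≡c j)))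
                                                (fromℕ<-injective _ _ (quotient<m i) (quotient<m j) eq) ⟩
    toℕ (f j) % k + toℕ (f j) / k * k      ≡⟨ m≡m%n+[m/n]*n (toℕ (f j)) k ⟨
    toℕ (f j)                              ∎))
  where
  open ≡-Reasoning
  quotient<m : ∀ i → toℕ (f i) / k < m
  quotient<m i = m<n*o⇒m/o<n (toℕ<n (f i))

-- The winding number of a directed cycle

module _ (k m : ℕ) .{{_ : NonZero k}} (m<mk : m < m * k) (k<N : k < m * k)
         (C : DirectedCycle (circulant k (m * k) k<N)) where
  open DirectedCycle C

  private
    N : ℕ
    N = m * k

    x : Fin (suc r) → ℕ
    x = toℕ ∘ vertex

    w : Fin r → ℕ
    w i = wrapCount k N (x (inject₁ i)) (x (suc i))

    -- `W` is the winding number; the primed quantities belong to the closing edge.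
    w′ W : ℕ
    w′ = wrapCount k N (x (fromℕ r)) (x zero)
    W = sum w + w′

    advance : ∀ i → ∃[ d ] x (suc i) + N * w i ≡ x (inject₁ i) + d × 1 ≤ d × d ≤ k
    advance i = arc-advance k N (toℕ<n (vertex (inject₁ i))) (toWitness (step i))

    d : Fin r → ℕ
    d i = proj₁ (advance i)

    d≤k : ∀ i → d i ≤ k
    d≤k i = proj₂ (proj₂ (proj₂ (advance i)))

    advance′ : ∃[ d′ ] x zero + N * w′ ≡ x (fromℕ r) + d′ × 1 ≤ d′ × d′ ≤ k
    advance′ = arc-advance k N (toℕ<n (vertex (fromℕ r))) (toWitness close)

    d′ : ℕ
    d′ = proj₁ advance′

    total-advance : N * W ≡ sum d + d′
    -- Both end positions are added to each side, so that the telescoped path and the closing edge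
    -- can be summed and then cancelled.
    total-advance = +-cancelˡ-≡ (xᵣ + x₀) _ _ (begin
      xᵣ + x₀ + N * (Σw + w′)          ≡⟨ regroup xᵣ x₀ N Σw w′ ⟩
      (xᵣ + N * Σw) + (x₀ + N * w′)    ≡⟨ cong₂ _+_ (telescope N x w d (λ i → proj₁ (proj₂ (advance i))))
                                                    (proj₁ (proj₂ advance′)) ⟩
      (x₀ + sum d) + (xᵣ + d′)         ≡⟨ interchange x₀ (sum d) xᵣ d′ ⟩
      xᵣ + x₀ + (sum d + d′)           ∎)
      where
      open ≡-Reasoning
      xᵣ = x (fromℕ r)
      x₀ = x zero
      Σw = sum w
      regroup : ∀ a b n p q → a + b + n * (p + q) ≡ (a + n * p) + (b + n * q)
      regroup = solve-∀
      interchange : ∀ a p b q → (a + p) + (b + q) ≡ b + a + (p + q)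
      interchange = solve-∀

    -- The closing edge alone already makes the total advance positive.
    1≤W : 1 ≤ W
    1≤W = n≢0⇒n>0 λ W≡0 → <⇒≱ (proj₁ (proj₂ (proj₂ advance′))) (begin
      d′          ≤⟨ m≤n+m d′ (sum d) ⟩
      sum d + d′  ≡⟨ total-advance ⟨
      N * W       ≡⟨ cong (N *_) W≡0 ⟩
      N * 0       ≡⟨ *-zeroʳ N ⟩
      0           ∎)
      where open ≤-Reasoning

    N≤length : k ≤ W → N ≤ suc r
    N≤length k≤W = *-cancelʳ-≤ N (suc r) k (begin
      N * k        ≤⟨ *-monoʳ-≤ N k≤W ⟩
      N * W        ≡⟨ total-advance ⟩
      sum d + d′   ≤⟨ +-mono-≤ (sum≤n*k d d≤k) (proj₂ (proj₂ (proj₂ advance′))) ⟩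
      r * k + k    ≡⟨ +-comm (r * k) k ⟩
      suc r * k    ∎)
      where open ≤-Reasoning

    -- Distinctness gives `suc r ≤ N`, so a total advance of at least `N * k` leaves no slack in any
    -- step.
    steps-maximal : k ≤ W → ∀ i → d i ≡ k
    steps-maximal k≤W = sum-maximal d d≤k (+-cancelʳ-≤ k (r * k) (sum d) (begin
      r * k + k    ≡⟨ +-comm (r * k) k ⟩
      suc r * k    ≤⟨ *-monoˡ-≤ k (injective⇒≤ distinct) ⟩
      N * k        ≤⟨ *-monoʳ-≤ N k≤W ⟩
      N * W        ≡⟨ total-advance ⟩
      sum d + d′   ≤⟨ +-monoʳ-≤ (sum d) (proj₂ (proj₂ (proj₂ advance′))) ⟩
      sum d + k    ∎))
      where open ≤-Reasoning

    -- Every step adds exactly `k`, and wrapping subtracts `N`, a multiple of `k`.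
    const-residue : k ≤ W → ∀ i → x i % k ≡ x zero % k
    const-residue k≤W = <-weakInduction _ refl λ i ih → begin
      x (suc i) % k              ≡⟨ %-remove-+ʳ (x (suc i)) (∣m⇒∣m*n (w i) (n∣m*n m)) ⟨
      (x (suc i) + N * w i) % k  ≡⟨ cong (_% k) (proj₁ (proj₂ (advance i))) ⟩
      (x (inject₁ i) + d i) % k  ≡⟨ cong (λ e → (x (inject₁ i) + e) % k) (steps-maximal k≤W i) ⟩
      (x (inject₁ i) + k) % k    ≡⟨ [m+n]%n≡m%n (x (inject₁ i)) k ⟩
      x (inject₁ i) % k          ≡⟨ ih ⟩
      x zero % k                 ∎
      where open ≡-Reasoning

    W<k : W < k
    -- If `k ≤ W`, then at least `N` distinct vertices share a residue class of size `m < N`.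
    W<k = ≰⇒> λ k≤W → <⇒≱ m<mk (≤-trans (N≤length k≤W)
      (injective-const-%⇒≤ m k vertex distinct _ (const-residue k≤W)))

    cycleSum≡W : cycleSum (circulant k N k<N) (wrapLabel k N k<N) C ≡ W mod k
    cycleSum≡W = trans (cong (_+ₖ (w′ mod k)) (sumₖ-mod k w)) (mod-+ₖ (sum w) w′ k)

  -- Since `0 < W < k`, reduction modulo `k` leaves `W` unchanged and nonzero.
  ¬zeroSum : ¬ ZeroSum (circulant k N k<N) (wrapLabel k N k<N) C
  ¬zeroSum zeroSum = <⇒≱ 1≤W (≤-reflexive (begin
    W                  ≡⟨ m<n⇒m%n≡m W<k ⟨
    W % k              ≡⟨ toℕ-mod W k ⟨
    toℕ (W mod k)      ≡⟨ cong toℕ (trans (sym cycleSum≡W) zeroSum) ⟩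
    toℕ (0 mod k)      ≡⟨ toℕ-mod 0 k ⟩
    -- The product `0 * k` in the library lemma reduces to `0`.
    0 % k              ≡⟨ m*n%n≡0 0 k ⟩
    0                  ∎))
    where open ≡-Reasoning

proposition6p2 : (k m : ℕ) .{{_ : NonZero k}} → 2 ≤ k → 2 ≤ m →
    Σ[ D ∈ Digraph (m * k) ]
    StronglyConnected D ×
    Regular D k ×
    (Σ[ label ∈ EdgeLabelling D (ℤmod k) ]
    ((C : DirectedCycle D) → ¬ ZeroSum D label C))
proposition6p2 k m 2≤k 2≤m =
  circulant k N k<N ,
  circulant-stronglyConnected k N (<⇒≤ 2≤k) k<N ,
  (λ v → count-outArcs k N (toℕ v) k<N (toℕ<n v) , count-inArcs k N (toℕ v) k<N (toℕ<n v)) ,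
  wrapLabel k N k<N ,
  ¬zeroSum k m m<N k<N
  where
  N : ℕ
  N = m * k

  -- From `m ≥ 2`: an arc is too short to return to its tail.
  k<N : k < N
  k<N = subst (k <_) (*-comm k m) (m<m*n k m 2≤m)

  -- From `k ≥ 2`: a residue class modulo `k` is not the whole vertex set.
  m<N : m < N
  m<N = m<m*n m k {{>-nonZero (<⇒≤ 2≤m)}} 2≤k
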